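{- Let $X\subseteq\{0,1\}^n$, let $Q$ be a real symmetric $n\times n$ matrix with rows $Q_1,\dots,Q_n$, let $\bar X\subseteq\mathbb{R}^n$ be a relaxation of $X$, and for $i=1,\dots,n$ let $$\overline{\gamma}_1^i=\max\{Q_ix:x\in\bar X,\,x_i=0\},\qquad \underline{\gamma}_1^i=\min\{Q_ix:x\in\bar X,\,x_i=1\},$$ $$\overline{\gamma}_2^i=\max\{Q_ix:x\in\bar X,\,x_i=1\},\qquad \underline{\gamma}_2^i=\min\{Q_ix:x\in\bar X,\,x_i=0\}.$$ Then for every $x\in X$ and all $i=1,\dots,n$, $$x_iQ_ix=\max\{\underline{\gamma}_1^ix_i,\;Q_ix+\overline{\gamma}_1^ix_i-\overline{\gamma}_1^i\},$$ $$x_iQ_ix=\min\{\overline{\gamma}_2^ix_i,\;Q_ix+\underline{\gamma}_2^ix_i-\underline{\gamma}_2^i\}.$$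
   Context: A relaxation of $X$ is a set $\bar X\subseteq\mathbb{R}^n$ with $X\subseteq\bar X$; it is assumed that all the minima and maxima above exist (are attained and finite). $Q_i x$ denotes the scalar product of the $i$-th row of $Q$ with $x$. -}

module Defs where

open import Algebra.Bundles.Raw using (RawMonoid)
import Algebra.Definitions.RawMonoid as RawMonoidOps
open import Data.Fin.Base using (Fin)
import Data.Nat.Base as ℕ
import Data.Nat.Properties as ℕₚ
open ℕ using (ℕ)
open import Data.Product.Base using (∃; _×_; _,_)
import Data.Rational.Base as ℚ
import Data.Rational.Properties as ℚₚ
open ℚ using (ℚ; 0ℚ; 1ℚ; ½)
open import Data.Rational.Solver using (module +-*-Solver)
open import Data.Sum.Base using (_⊎_; inj₁; inj₂)
open import Data.Vec.Functional using (Vector; zipWith)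
open import Data.Vec.Functional.Relation.Binary.Pointwise using (Pointwise)
open import Level using (Level; 0ℓ)
open import Relation.Binary.Definitions using (_Respects_)
open import Relation.Binary.PropositionalEquality
  using (_≡_; refl; sym; trans; cong; subst)
open import Relation.Unary using (Pred; _∈_)

private
  variable
    ℓ : Level
    n : ℕ

-- The reals are Cauchy sequences of rationals, with the setoid equality
-- "the difference tends to 0" in place of a quotient.

Eventually : Pred ℕ ℓ → Set ℓ
Eventually P = ∃ λ N → ∀ k → N ℕ.≤ k → P k

IsCauchy : (ℕ → ℚ) → Set
IsCauchy x = ∀ ε → 0ℚ ℚ.< ε →
  ∃ λ N → ∀ j k → N ℕ.≤ j → N ℕ.≤ k → ℚ.∣ x j ℚ.- x k ∣ ℚ.≤ ε

record ℝ : Set where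
  constructor mkℝ
  field
    seq    : ℕ → ℚ
    cauchy : IsCauchy seq

open ℝ public

infix 4 _≈_ _≤_

_≈_ : ℝ → ℝ → Set
x ≈ y = ∀ ε → 0ℚ ℚ.< ε → Eventually λ k → ℚ.∣ seq x k ℚ.- seq y k ∣ ℚ.≤ ε

_≤_ : ℝ → ℝ → Set
x ≤ y = ∀ ε → 0ℚ ℚ.< ε → Eventually λ k → seq x k ℚ.≤ seq y k ℚ.+ ε

private
  open ℚₚ.≤-Reasoning

  module Identities where
    open import Data.Rational.Base using (_+_; _-_; _*_; -_)
    open +-*-Solver

    p≡q+[p-q] : ∀ p q → p ≡ q + (p - q)
    p≡q+[p-q] = solve 2 (λ p q → p := q :+ (p :- q)) refl

    -[p-q]≡q-p : ∀ p q → - (p - q) ≡ q - p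
    -[p-q]≡q-p = solve 2 (λ p q → :- (p :- q) := q :- p) refl

    q-p≡-p-[-q] : ∀ p q → q - p ≡ - p - (- q)
    q-p≡-p-[-q] = solve 2 (λ p q → q :- p := :- p :- (:- q)) refl

    q+e-q≡e : ∀ q e → q + e - q ≡ e
    q+e-q≡e = solve 2 (λ q e → q :+ e :- q := e) refl

    +-difference : ∀ a b c d → a + b - (c + d) ≡ (a - c) + (b - d)
    +-difference = solve 4 (λ a b c d → a :+ b :- (c :+ d) := (a :- c) :+ (b :- d)) refl

    *-difference : ∀ a b c d → a * b - c * d ≡ a * (b - d) + d * (a - c)
    *-difference = solve 4 (λ a b c d → a :* b :- c :* d := a :* (b :- d) :+ d :* (a :- c)) refl

    ½e+½e≡e : ∀ e → ½ * e + ½ * e ≡ e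
    ½e+½e≡e = solve 1 (λ e → con ½ :* e :+ con ½ :* e := e) refl

    b[er]≡e[br] : ∀ b e r → b * (e * r) ≡ e * (b * r)
    b[er]≡e[br] = solve 3 (λ b e r → b :* (e :* r) := e :* (b :* r)) refl

  open Identities

∣p-q∣≤ε⇒p≤q+ε : ∀ p q {ε} → ℚ.∣ p ℚ.- q ∣ ℚ.≤ ε → p ℚ.≤ q ℚ.+ ε
∣p-q∣≤ε⇒p≤q+ε p q {ε} h = begin
  p                      ≡⟨ p≡q+[p-q] p q ⟩
  q ℚ.+ (p ℚ.- q)        ≤⟨ ℚₚ.+-monoʳ-≤ q (p≤∣p∣ (p ℚ.- q)) ⟩
  q ℚ.+ ℚ.∣ p ℚ.- q ∣    ≤⟨ ℚₚ.+-monoʳ-≤ q h ⟩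
  q ℚ.+ ε                ∎
  where
  p≤∣p∣ : ∀ p → p ℚ.≤ ℚ.∣ p ∣
  p≤∣p∣ p with ℚₚ.≤-total 0ℚ p
  ... | inj₁ 0≤p = ℚₚ.≤-reflexive (sym (ℚₚ.0≤p⇒∣p∣≡p 0≤p))
  ... | inj₂ p≤0 = ℚₚ.≤-trans p≤0 (ℚₚ.0≤∣p∣ p)

∣-∣-swap : ∀ p q → ℚ.∣ p ℚ.- q ∣ ≡ ℚ.∣ q ℚ.- p ∣
∣-∣-swap p q = trans (sym (ℚₚ.∣-p∣≡∣p∣ (p ℚ.- q)))
  (cong ℚ.∣_∣ (-[p-q]≡q-p p q))

∣p-q∣≤ε⇒q≤p+ε : ∀ p q {ε} → ℚ.∣ p ℚ.- q ∣ ℚ.≤ ε → q ℚ.≤ p ℚ.+ ε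
∣p-q∣≤ε⇒q≤p+ε p q {ε} h =
  ∣p-q∣≤ε⇒p≤q+ε q p (subst (ℚ._≤ ε) (∣-∣-swap p q) h)

p≤q+ε⇒p-q≤ε : ∀ p q {ε} → p ℚ.≤ q ℚ.+ ε → p ℚ.- q ℚ.≤ ε
p≤q+ε⇒p-q≤ε p q {ε} h = begin
  p ℚ.- q            ≤⟨ ℚₚ.+-monoˡ-≤ (ℚ.- q) h ⟩
  q ℚ.+ ε ℚ.- q      ≡⟨ q+e-q≡e q ε ⟩
  ε                  ∎

≤+ε⇒∣-∣≤ε : ∀ p q {ε} → p ℚ.≤ q ℚ.+ ε → q ℚ.≤ p ℚ.+ ε → ℚ.∣ p ℚ.- q ∣ ℚ.≤ ε
≤+ε⇒∣-∣≤ε p q {ε} h₁ h₂ with ℚₚ.∣p∣≡p∨∣p∣≡-p (p ℚ.- q)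
... | inj₁ eq = subst (ℚ._≤ ε) (sym eq) (p≤q+ε⇒p-q≤ε p q h₁)
... | inj₂ eq = subst (ℚ._≤ ε)
  (sym (trans eq (-[p-q]≡q-p p q)))
  (p≤q+ε⇒p-q≤ε q p h₂)

⊔-≤+ε : ∀ a b c d {ε} → a ℚ.≤ c ℚ.+ ε → b ℚ.≤ d ℚ.+ ε →
         a ℚ.⊔ b ℚ.≤ (c ℚ.⊔ d) ℚ.+ ε
⊔-≤+ε a b c d {ε} h₁ h₂ = ℚₚ.⊔-lub
  (ℚₚ.≤-trans h₁ (ℚₚ.+-monoˡ-≤ ε (ℚₚ.p≤p⊔q c d)))
  (ℚₚ.≤-trans h₂ (ℚₚ.+-monoˡ-≤ ε (ℚₚ.p≤q⊔p c d)))

⊓-≤+ε : ∀ a b c d {ε} → a ℚ.≤ c ℚ.+ ε → b ℚ.≤ d ℚ.+ ε →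
         a ℚ.⊓ b ℚ.≤ (c ℚ.⊓ d) ℚ.+ ε
⊓-≤+ε a b c d {ε} h₁ h₂ =
  subst (a ℚ.⊓ b ℚ.≤_)
    (sym (ℚₚ.mono-≤-distrib-⊓ (ℚₚ.+-monoˡ-≤ ε) c d))
    (ℚₚ.⊓-glb (ℚₚ.≤-trans (ℚₚ.p⊓q≤p a b) h₁) (ℚₚ.≤-trans (ℚₚ.p⊓q≤q a b) h₂))

const-cauchy : ∀ q → IsCauchy (λ _ → q)
const-cauchy q ε 0<ε = 0 , λ _ _ _ _ →
  subst (λ r → ℚ.∣ r ∣ ℚ.≤ ε) (sym (ℚₚ.+-inverseʳ q)) (ℚₚ.<⇒≤ 0<ε)

+-cauchy : ∀ x y → IsCauchy x → IsCauchy y → IsCauchy (λ k → x k ℚ.+ y k)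
+-cauchy x y cx cy ε 0<ε with cx (½ ℚ.* ε) 0<½ε | cy (½ ℚ.* ε) 0<½ε
  where
  0<½ε : 0ℚ ℚ.< ½ ℚ.* ε
  0<½ε = subst (ℚ._< ½ ℚ.* ε) (ℚₚ.*-zeroʳ ½) (ℚₚ.*-monoʳ-<-pos ½ 0<ε)
... | M , hx | N , hy = M ℕ.⊔ N , λ j k hj hk → begin
  ℚ.∣ x j ℚ.+ y j ℚ.- (x k ℚ.+ y k) ∣
    ≡⟨ cong ℚ.∣_∣ (+-difference (x j) (y j) (x k) (y k)) ⟩
  ℚ.∣ (x j ℚ.- x k) ℚ.+ (y j ℚ.- y k) ∣
    ≤⟨ ℚₚ.∣p+q∣≤∣p∣+∣q∣ (x j ℚ.- x k) (y j ℚ.- y k) ⟩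
  ℚ.∣ x j ℚ.- x k ∣ ℚ.+ ℚ.∣ y j ℚ.- y k ∣
    ≤⟨ ℚₚ.+-mono-≤ (hx j k (ℕₚ.m⊔n≤o⇒m≤o M N hj) (ℕₚ.m⊔n≤o⇒m≤o M N hk))
                   (hy j k (ℕₚ.m⊔n≤o⇒n≤o M N hj) (ℕₚ.m⊔n≤o⇒n≤o M N hk)) ⟩
  ½ ℚ.* ε ℚ.+ ½ ℚ.* ε
    ≡⟨ ½e+½e≡e ε ⟩
  ε ∎

-‿cauchy : ∀ x → IsCauchy x → IsCauchy (λ k → ℚ.- x k)
-‿cauchy x cx ε 0<ε with cx ε 0<ε
... | N , hx = N , λ j k hj hk →
  subst (ℚ._≤ ε)
    (trans (∣-∣-swap (x j) (x k))
      (cong ℚ.∣_∣ (q-p≡-p-[-q] (x j) (x k))))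
    (hx j k hj hk)

⊔-cauchy : ∀ x y → IsCauchy x → IsCauchy y → IsCauchy (λ k → x k ℚ.⊔ y k)
⊔-cauchy x y cx cy ε 0<ε with cx ε 0<ε | cy ε 0<ε
... | M , hx | N , hy = M ℕ.⊔ N , λ j k hj hk →
  let hx′ = hx j k (ℕₚ.m⊔n≤o⇒m≤o M N hj) (ℕₚ.m⊔n≤o⇒m≤o M N hk)
      hy′ = hy j k (ℕₚ.m⊔n≤o⇒n≤o M N hj) (ℕₚ.m⊔n≤o⇒n≤o M N hk)
  in ≤+ε⇒∣-∣≤ε (x j ℚ.⊔ y j) (x k ℚ.⊔ y k)
    (⊔-≤+ε (x j) (y j) (x k) (y k)
      (∣p-q∣≤ε⇒p≤q+ε (x j) (x k) hx′) (∣p-q∣≤ε⇒p≤q+ε (y j) (y k) hy′))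
    (⊔-≤+ε (x k) (y k) (x j) (y j)
      (∣p-q∣≤ε⇒q≤p+ε (x j) (x k) hx′) (∣p-q∣≤ε⇒q≤p+ε (y j) (y k) hy′))

⊓-cauchy : ∀ x y → IsCauchy x → IsCauchy y → IsCauchy (λ k → x k ℚ.⊓ y k)
⊓-cauchy x y cx cy ε 0<ε with cx ε 0<ε | cy ε 0<ε
... | M , hx | N , hy = M ℕ.⊔ N , λ j k hj hk →
  let hx′ = hx j k (ℕₚ.m⊔n≤o⇒m≤o M N hj) (ℕₚ.m⊔n≤o⇒m≤o M N hk)
      hy′ = hy j k (ℕₚ.m⊔n≤o⇒n≤o M N hj) (ℕₚ.m⊔n≤o⇒n≤o M N hk)
  in ≤+ε⇒∣-∣≤ε (x j ℚ.⊓ y j) (x k ℚ.⊓ y k)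
    (⊓-≤+ε (x j) (y j) (x k) (y k)
      (∣p-q∣≤ε⇒p≤q+ε (x j) (x k) hx′) (∣p-q∣≤ε⇒p≤q+ε (y j) (y k) hy′))
    (⊓-≤+ε (x k) (y k) (x j) (y j)
      (∣p-q∣≤ε⇒q≤p+ε (x j) (x k) hx′) (∣p-q∣≤ε⇒q≤p+ε (y j) (y k) hy′))

eventually-bounded : ∀ {x} → IsCauchy x →
  ∃ λ B → 0ℚ ℚ.< B × Eventually λ k → ℚ.∣ x k ∣ ℚ.≤ B
eventually-bounded {x} cx with cx 1ℚ (ℚₚ.positive⁻¹ 1ℚ)
... | N , h = 1ℚ ℚ.+ ℚ.∣ x N ∣ ,
  ℚₚ.+-mono-<-≤ (ℚₚ.positive⁻¹ 1ℚ) (ℚₚ.0≤∣p∣ (x N)) ,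
  N , λ k N≤k → begin
    ℚ.∣ x k ∣
      ≡⟨ cong ℚ.∣_∣ (trans (p≡q+[p-q] (x k) (x N)) (ℚₚ.+-comm (x N) (x k ℚ.- x N))) ⟩
    ℚ.∣ (x k ℚ.- x N) ℚ.+ x N ∣
      ≤⟨ ℚₚ.∣p+q∣≤∣p∣+∣q∣ (x k ℚ.- x N) (x N) ⟩
    ℚ.∣ x k ℚ.- x N ∣ ℚ.+ ℚ.∣ x N ∣
      ≤⟨ ℚₚ.+-monoˡ-≤ ℚ.∣ x N ∣ (h k N N≤k ℕₚ.≤-refl) ⟩
    1ℚ ℚ.+ ℚ.∣ x N ∣ ∎

∣p*q∣≤ : ∀ p q {B δ} → 0ℚ ℚ.< B → ℚ.∣ p ∣ ℚ.≤ B → ℚ.∣ q ∣ ℚ.≤ δ →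
         ℚ.∣ p ℚ.* q ∣ ℚ.≤ B ℚ.* δ
∣p*q∣≤ p q {B} {δ} 0<B hp hq = begin
  ℚ.∣ p ℚ.* q ∣            ≡⟨ ℚₚ.∣p*q∣≡∣p∣*∣q∣ p q ⟩
  ℚ.∣ p ∣ ℚ.* ℚ.∣ q ∣
    ≤⟨ ℚₚ.*-monoʳ-≤-nonNeg ℚ.∣ q ∣ {{ℚₚ.∣-∣-nonNeg q}} hp ⟩
  B ℚ.* ℚ.∣ q ∣
    ≤⟨ ℚₚ.*-monoˡ-≤-nonNeg B {{ℚ.nonNegative (ℚₚ.<⇒≤ 0<B)}} hq ⟩
  B ℚ.* δ                  ∎

pos-divisor : ∀ B ε → 0ℚ ℚ.< B → 0ℚ ℚ.< ε →
              ∃ λ δ → 0ℚ ℚ.< δ × B ℚ.* δ ≡ ε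
pos-divisor B ε 0<B 0<ε = ε ℚ.* 1/B , 0<δ ,
  trans (b[er]≡e[br] B ε 1/B)
    (trans (cong (ε ℚ.*_) (ℚₚ.*-inverseʳ B)) (ℚₚ.*-identityʳ ε))
  where
  instance
    B-pos     = ℚ.positive 0<B
    B-nonZero = ℚₚ.pos⇒nonZero B
  1/B = ℚ.1/ B
  0<δ : 0ℚ ℚ.< ε ℚ.* 1/B
  0<δ = subst (ℚ._< ε ℚ.* 1/B) (ℚₚ.*-zeroˡ 1/B)
    (ℚₚ.*-monoˡ-<-pos 1/B {{ℚₚ.1/pos⇒pos B}} 0<ε)

∣ab-cd∣≤ : ∀ a b c d A B δ → 0ℚ ℚ.< A → 0ℚ ℚ.< B →
  ℚ.∣ a ∣ ℚ.≤ A → ℚ.∣ d ∣ ℚ.≤ B → ℚ.∣ a ℚ.- c ∣ ℚ.≤ δ → ℚ.∣ b ℚ.- d ∣ ℚ.≤ δ →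
  ℚ.∣ a ℚ.* b ℚ.- c ℚ.* d ∣ ℚ.≤ (A ℚ.+ B) ℚ.* δ
∣ab-cd∣≤ a b c d A B δ 0<A 0<B ha hd hac hbd = begin
  ℚ.∣ a ℚ.* b ℚ.- c ℚ.* d ∣
    ≡⟨ cong ℚ.∣_∣ (*-difference a b c d) ⟩
  ℚ.∣ a ℚ.* (b ℚ.- d) ℚ.+ d ℚ.* (a ℚ.- c) ∣
    ≤⟨ ℚₚ.∣p+q∣≤∣p∣+∣q∣ (a ℚ.* (b ℚ.- d)) (d ℚ.* (a ℚ.- c)) ⟩
  ℚ.∣ a ℚ.* (b ℚ.- d) ∣ ℚ.+ ℚ.∣ d ℚ.* (a ℚ.- c) ∣
    ≤⟨ ℚₚ.+-mono-≤ (∣p*q∣≤ a (b ℚ.- d) 0<A ha hbd) (∣p*q∣≤ d (a ℚ.- c) 0<B hd hac) ⟩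
  A ℚ.* δ ℚ.+ B ℚ.* δ
    ≡⟨ ℚₚ.*-distribʳ-+ δ A B ⟨
  (A ℚ.+ B) ℚ.* δ ∎

*-cauchy : ∀ x y → IsCauchy x → IsCauchy y → IsCauchy (λ k → x k ℚ.* y k)
*-cauchy x y cx cy ε 0<ε =
  let A , 0<A , K , hA = eventually-bounded cx
      B , 0<B , L , hB = eventually-bounded cy
      δ , 0<δ , [A+B]δ≡ε = pos-divisor (A ℚ.+ B) ε (ℚₚ.+-mono-< 0<A 0<B) 0<ε
      M , hx = cx δ 0<δ
      N , hy = cy δ 0<δ
      P = K ℕ.⊔ L
      R = M ℕ.⊔ N
  in P ℕ.⊔ R , λ j k hj hk →
    let hjP = ℕₚ.m⊔n≤o⇒m≤o P R hj
        hkP = ℕₚ.m⊔n≤o⇒m≤o P R hk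
        hjR = ℕₚ.m⊔n≤o⇒n≤o P R hj
        hkR = ℕₚ.m⊔n≤o⇒n≤o P R hk
    in subst (ℚ.∣ x j ℚ.* y j ℚ.- x k ℚ.* y k ∣ ℚ.≤_) [A+B]δ≡ε
      (∣ab-cd∣≤ (x j) (y j) (x k) (y k) A B δ 0<A 0<B
        (hA j (ℕₚ.m⊔n≤o⇒m≤o K L hjP)) (hB k (ℕₚ.m⊔n≤o⇒n≤o K L hkP))
        (hx j k (ℕₚ.m⊔n≤o⇒m≤o M N hjR) (ℕₚ.m⊔n≤o⇒m≤o M N hkR))
        (hy j k (ℕₚ.m⊔n≤o⇒n≤o M N hjR) (ℕₚ.m⊔n≤o⇒n≤o M N hkR)))

infixl 7 _*_ _⊓_
infixl 6 _+_ _-_ _⊔_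
infix  8 -_

0ℝ 1ℝ : ℝ
0ℝ = mkℝ (λ _ → 0ℚ) (const-cauchy 0ℚ)
1ℝ = mkℝ (λ _ → 1ℚ) (const-cauchy 1ℚ)

-_ : ℝ → ℝ
- x = mkℝ (λ k → ℚ.- seq x k) (-‿cauchy (seq x) (cauchy x))

-- The termwise ⊔ and ⊓ are the binary maximum and minimum (the join and
-- the meet for _≤_).
_+_ _-_ _*_ _⊔_ _⊓_ : ℝ → ℝ → ℝ
x + y = mkℝ (λ k → seq x k ℚ.+ seq y k) (+-cauchy (seq x) (seq y) (cauchy x) (cauchy y))
x - y = x + (- y)
x * y = mkℝ (λ k → seq x k ℚ.* seq y k) (*-cauchy (seq x) (seq y) (cauchy x) (cauchy y))
x ⊔ y = mkℝ (λ k → seq x k ℚ.⊔ seq y k) (⊔-cauchy (seq x) (seq y) (cauchy x) (cauchy y))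
x ⊓ y = mkℝ (λ k → seq x k ℚ.⊓ seq y k) (⊓-cauchy (seq x) (seq y) (cauchy x) (cauchy y))

+-0-rawMonoid : RawMonoid 0ℓ 0ℓ
+-0-rawMonoid = record { Carrier = ℝ ; _≈_ = _≈_ ; _∙_ = _+_ ; ε = 0ℝ }

infix 8 _·_

_·_ : Vector ℝ n → Vector ℝ n → ℝ
u · v = RawMonoidOps.sum +-0-rawMonoid (zipWith _*_ u v)

-- A matrix is the vector of its rows.
Matrix : ℕ → Set
Matrix n = Vector (Vector ℝ n) n

Symmetric : Matrix n → Set
Symmetric Q = ∀ i j → Q i j ≈ Q j i

BinaryVectors : ∀ n → Pred (Vector ℝ n) 0ℓ
BinaryVectors n x = ∀ i → x i ≈ 0ℝ ⊎ x i ≈ 1ℝ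

-- Since ℝ carries a setoid equality, a subset of ℝⁿ is a predicate that
-- does not distinguish equal vectors.
Extensional : Pred (Vector ℝ n) ℓ → Set ℓ
Extensional S = S Respects (Pointwise _≈_)

Image : (Vector ℝ n → ℝ) → Pred (Vector ℝ n) ℓ → Pred ℝ ℓ
Image f S r = ∃ λ x → x ∈ S × r ≈ f x

-- Extrema are attained: membership is up to _≈_ by the definition of Image.
IsMax IsMin : Pred ℝ ℓ → ℝ → Set ℓ
IsMax S m = m ∈ S × (∀ {r} → r ∈ S → r ≤ m)
IsMin S m = m ∈ S × (∀ {r} → r ∈ S → m ≤ r)

-- { Qᵢ x : x ∈ S, xᵢ = c }
RowValues : Matrix n → Pred (Vector ℝ n) ℓ → Fin n → ℝ → Pred ℝ ℓ
RowValues Q S i c = Image (Q i ·_) (λ x → x ∈ S × x i ≈ c)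

{-# OPTIONS --safe #-}

-- Both sides depend on xᵢ only up to ≈, so it suffices to take xᵢ = 0 and xᵢ = 1.
-- In each case one of the two arguments of the max (min) equals xᵢ Qᵢx identically,
-- and the bound on Qᵢx defining the relevant γ says that it is the larger (smaller) one.

module Submission where

open import Defs
open import Data.Nat.Base using (ℕ)
import Data.Nat.Base as ℕ
import Data.Nat.Properties as ℕₚ
open import Data.Product.Base using (_×_; _,_; ∃)
import Data.Rational.Base as ℚ
import Data.Rational.Properties as ℚₚ
open ℚ using (ℚ; 0ℚ; 1ℚ; ½)
open import Data.Rational.Solver using (module +-*-Solver)
open import Data.Sum.Base using (_⊎_; inj₁; inj₂)
open import Data.Vec.Functional using (Vector)
open import Level using (Level; 0ℓ)
open import Relation.Binary.Bundles using (Setoid)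
open import Relation.Binary.PropositionalEquality
  using (_≡_; refl; sym; trans; cong; subst)
import Relation.Binary.Reasoning.Setoid as SetoidReasoning
open import Relation.Unary using (Pred; _∈_; _⊆_)

private
  variable
    ℓ₁ ℓ₂ ℓ₃ : Level

-- Identities in the field of rationals.

module RationalIdentities where
  open +-*-Solver

  ½e+½e≡e : ∀ e → ½ ℚ.* e ℚ.+ ½ ℚ.* e ≡ e
  ½e+½e≡e = solve 1 (λ e → con ½ :* e :+ con ½ :* e := e) refl

  q+[p-q]≡p : ∀ p q → q ℚ.+ (p ℚ.- q) ≡ p
  q+[p-q]≡p = solve 2 (λ p q → q :+ (p :- q) := p) refl

  telescope : ∀ p q r → p ℚ.- r ≡ (p ℚ.- q) ℚ.+ (q ℚ.- r)
  telescope = solve 3 (λ p q r → p :- r := (p :- q) :+ (q :- r)) refl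

  +-difference : ∀ a b c d → a ℚ.+ b ℚ.- (c ℚ.+ d) ≡ (a ℚ.- c) ℚ.+ (b ℚ.- d)
  +-difference = solve 4 (λ a b c d → a :+ b :- (c :+ d) := (a :- c) :+ (b :- d)) refl

  0r≡a0 : ∀ a r → 0ℚ ℚ.* r ≡ a ℚ.* 0ℚ
  0r≡a0 = solve 2 (λ a r → con 0ℚ :* r := a :* con 0ℚ) refl

  1r≡r+b1-b : ∀ b r → 1ℚ ℚ.* r ≡ r ℚ.+ b ℚ.* 1ℚ ℚ.- b
  1r≡r+b1-b = solve 2 (λ b r → con 1ℚ :* r := r :+ b :* con 1ℚ :- b) refl

  -- These four evaluate, at 0 and at 1, the difference of the two arguments of the max or min. At 0
  -- the slope `a` drops out, at 1 the slope `b` cancels; what is left is the comparison of `r` with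
  -- a single extremum.
  [r+b0-b]-a0≡r-b : ∀ a b r → r ℚ.+ b ℚ.* 0ℚ ℚ.- b ℚ.- a ℚ.* 0ℚ ≡ r ℚ.- b
  [r+b0-b]-a0≡r-b = solve 3 (λ a b r → r :+ b :* con 0ℚ :- b :- a :* con 0ℚ := r :- b) refl

  a0-[r+b0-b]≡b-r : ∀ a b r → a ℚ.* 0ℚ ℚ.- (r ℚ.+ b ℚ.* 0ℚ ℚ.- b) ≡ b ℚ.- r
  a0-[r+b0-b]≡b-r = solve 3 (λ a b r → a :* con 0ℚ :- (r :+ b :* con 0ℚ :- b) := b :- r) refl

  [r+b1-b]-a1≡r-a : ∀ a b r → r ℚ.+ b ℚ.* 1ℚ ℚ.- b ℚ.- a ℚ.* 1ℚ ≡ r ℚ.- a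
  [r+b1-b]-a1≡r-a = solve 3 (λ a b r → r :+ b :* con 1ℚ :- b :- a :* con 1ℚ := r :- a) refl

  a1-[r+b1-b]≡a-r : ∀ a b r → a ℚ.* 1ℚ ℚ.- (r ℚ.+ b ℚ.* 1ℚ ℚ.- b) ≡ a ℚ.- r
  a1-[r+b1-b]≡a-r = solve 3 (λ a b r → a :* con 1ℚ :- (r :+ b :* con 1ℚ :- b) := a :- r) refl

open RationalIdentities

-- Eventual properties and choices of ε.

Eventually-map : {P : Pred ℕ ℓ₁} {R : Pred ℕ ℓ₂} →
  (∀ k → P k → R k) → Eventually P → Eventually R
Eventually-map f (N , h) = N , λ k N≤k → f k (h k N≤k)

Eventually-zipWith : {P : Pred ℕ ℓ₁} {Q : Pred ℕ ℓ₂} {R : Pred ℕ ℓ₃} →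
  (∀ k → P k → Q k → R k) → Eventually P → Eventually Q → Eventually R
Eventually-zipWith f (M , g) (N , h) = M ℕ.⊔ N , λ k M⊔N≤k →
  f k (g k (ℕₚ.m⊔n≤o⇒m≤o M N M⊔N≤k)) (h k (ℕₚ.m⊔n≤o⇒n≤o M N M⊔N≤k))

p≤p+ε : ∀ p {ε} → 0ℚ ℚ.< ε → p ℚ.≤ p ℚ.+ ε
p≤p+ε p {ε} 0<ε =
  subst (ℚ._≤ p ℚ.+ ε) (ℚₚ.+-identityʳ p) (ℚₚ.+-monoʳ-≤ p (ℚₚ.<⇒≤ 0<ε))

halve : ∀ ε → 0ℚ ℚ.< ε → ∃ λ δ → 0ℚ ℚ.< δ × δ ℚ.+ δ ≡ ε
halve ε 0<ε = ½ ℚ.* ε ,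
  subst (ℚ._< ½ ℚ.* ε) (ℚₚ.*-zeroʳ ½) (ℚₚ.*-monoʳ-<-pos ½ 0<ε) ,
  ½e+½e≡e ε

-- Equality of reals as a congruence.

≡⇒≈ : ∀ x y → (∀ k → seq x k ≡ seq y k) → x ≈ y
≡⇒≈ x y x≡y ε 0<ε = 0 , λ k _ →
  subst (λ q → ℚ.∣ seq x k ℚ.- q ∣ ℚ.≤ ε) (x≡y k)
    (subst (λ d → ℚ.∣ d ∣ ℚ.≤ ε) (sym (ℚₚ.+-inverseʳ (seq x k))) (ℚₚ.<⇒≤ 0<ε))

≈-refl : ∀ x → x ≈ x
≈-refl x = ≡⇒≈ x x (λ _ → refl)

≈-sym : ∀ x y → x ≈ y → y ≈ x
≈-sym x y x≈y ε 0<ε = Eventually-map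
  (λ k → subst (ℚ._≤ ε) (∣-∣-swap (seq x k) (seq y k))) (x≈y ε 0<ε)

-- By the triangle inequality, each of the two differences may use up half of ε. Transitivity and
-- the congruence of addition are both instances.
≈-byDifferences : ∀ w z x x′ y y′ →
  (∀ k → seq w k ℚ.- seq z k ≡
         (seq x k ℚ.- seq x′ k) ℚ.+ (seq y k ℚ.- seq y′ k)) →
  x ≈ x′ → y ≈ y′ → w ≈ z
≈-byDifferences w z x x′ y y′ eq x≈x′ y≈y′ ε 0<ε with halve ε 0<ε
... | δ , 0<δ , δ+δ≡ε = Eventually-zipWith bound (x≈x′ δ 0<δ) (y≈y′ δ 0<δ)
  where
  open ℚₚ.≤-Reasoning
  bound : ∀ k → ℚ.∣ seq x k ℚ.- seq x′ k ∣ ℚ.≤ δ → ℚ.∣ seq y k ℚ.- seq y′ k ∣ ℚ.≤ δ →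
    ℚ.∣ seq w k ℚ.- seq z k ∣ ℚ.≤ ε
  bound k hx hy = begin
    ℚ.∣ seq w k ℚ.- seq z k ∣
      ≡⟨ cong ℚ.∣_∣ (eq k) ⟩
    ℚ.∣ (seq x k ℚ.- seq x′ k) ℚ.+ (seq y k ℚ.- seq y′ k) ∣
      ≤⟨ ℚₚ.∣p+q∣≤∣p∣+∣q∣ (seq x k ℚ.- seq x′ k) (seq y k ℚ.- seq y′ k) ⟩
    ℚ.∣ seq x k ℚ.- seq x′ k ∣ ℚ.+ ℚ.∣ seq y k ℚ.- seq y′ k ∣
      ≤⟨ ℚₚ.+-mono-≤ hx hy ⟩
    δ ℚ.+ δ
      ≡⟨ δ+δ≡ε ⟩
    ε ∎

≈-trans : ∀ x y z → x ≈ y → y ≈ z → x ≈ z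
≈-trans x y z = ≈-byDifferences x z x y y z λ k →
  telescope (seq x k) (seq y k) (seq z k)

≈-setoid : Setoid 0ℓ 0ℓ
≈-setoid = record
  { Carrier = ℝ
  ; _≈_ = _≈_
  ; isEquivalence = record
    { refl  = λ {x} → ≈-refl x
    ; sym   = λ {x} {y} → ≈-sym x y
    ; trans = λ {x} {y} {z} → ≈-trans x y z
    }
  }

Congruent : (ℝ → ℝ → ℝ) → Set
Congruent _∙_ = ∀ x x′ y y′ → x ≈ x′ → y ≈ y′ → (x ∙ y) ≈ (x′ ∙ y′)

+-cong : Congruent _+_
+-cong x x′ y y′ = ≈-byDifferences (x + y) (x′ + y′) x x′ y y′ λ k →
  +-difference (seq x k) (seq y k) (seq x′ k) (seq y′ k)

*-cong : Congruent _*_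
*-cong x x′ y y′ x≈x′ y≈y′ ε 0<ε =
  -- Since `xy - x′y′ = x(y - y′) + y′(x - x′)`, it is `x` and `y′` that must be bounded, and `δ` is
  -- chosen with `(A + B)δ = ε`.
  let A , 0<A , bounded-x  = eventually-bounded (cauchy x)
      B , 0<B , bounded-y′ = eventually-bounded (cauchy y′)
      δ , 0<δ , [A+B]δ≡ε = pos-divisor (A ℚ.+ B) ε (ℚₚ.+-mono-< 0<A 0<B) 0<ε
  in Eventually-zipWith
    (λ k (hx , hy′) (hxx′ , hyy′) →
      subst (ℚ.∣ seq x k ℚ.* seq y k ℚ.- seq x′ k ℚ.* seq y′ k ∣ ℚ.≤_) [A+B]δ≡ε
        (∣ab-cd∣≤ (seq x k) (seq y k) (seq x′ k) (seq y′ k) A B δ 0<A 0<B hx hy′ hxx′ hyy′))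
    (Eventually-zipWith (λ _ → _,_) bounded-x bounded-y′)
    (Eventually-zipWith (λ _ → _,_) (x≈x′ δ 0<δ) (y≈y′ δ 0<δ))

-- An error of at most ε in each argument moves a maximum by at most ε, so ε need not be split. Each
-- of the two one-sided bounds follows from monotonicity.
⊔-cong : Congruent _⊔_
⊔-cong x x′ y y′ x≈x′ y≈y′ ε 0<ε = Eventually-zipWith
  (λ k hx hy →
    let a = seq x k ; a′ = seq x′ k ; b = seq y k ; b′ = seq y′ k in
    ≤+ε⇒∣-∣≤ε (a ℚ.⊔ b) (a′ ℚ.⊔ b′)
      (⊔-≤+ε a b a′ b′ (∣p-q∣≤ε⇒p≤q+ε a a′ hx) (∣p-q∣≤ε⇒p≤q+ε b b′ hy))
      (⊔-≤+ε a′ b′ a b (∣p-q∣≤ε⇒q≤p+ε a a′ hx) (∣p-q∣≤ε⇒q≤p+ε b b′ hy)))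
  (x≈x′ ε 0<ε) (y≈y′ ε 0<ε)

⊓-cong : Congruent _⊓_
⊓-cong x x′ y y′ x≈x′ y≈y′ ε 0<ε = Eventually-zipWith
  (λ k hx hy →
    let a = seq x k ; a′ = seq x′ k ; b = seq y k ; b′ = seq y′ k in
    ≤+ε⇒∣-∣≤ε (a ℚ.⊓ b) (a′ ℚ.⊓ b′)
      (⊓-≤+ε a b a′ b′ (∣p-q∣≤ε⇒p≤q+ε a a′ hx) (∣p-q∣≤ε⇒p≤q+ε b b′ hy))
      (⊓-≤+ε a′ b′ a b (∣p-q∣≤ε⇒q≤p+ε a a′ hx) (∣p-q∣≤ε⇒q≤p+ε b b′ hy)))
  (x≈x′ ε 0<ε) (y≈y′ ε 0<ε)

-- Order, maximum and minimum of reals.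

y≤x⇒x≈x⊔y : ∀ x y → y ≤ x → x ≈ x ⊔ y
y≤x⇒x≈x⊔y x y y≤x ε 0<ε = Eventually-map
  (λ k b≤a+ε → let a = seq x k ; b = seq y k in
    -- The order on reals gives only `b ≤ a + ε` for late terms, so the termwise maximum may differ
    -- from `a`, but it lies between `a` and `a + ε`.
    ≤+ε⇒∣-∣≤ε a (a ℚ.⊔ b)
      (ℚₚ.≤-trans (ℚₚ.p≤p⊔q a b) (p≤p+ε (a ℚ.⊔ b) 0<ε))
      (ℚₚ.⊔-lub (p≤p+ε a 0<ε) b≤a+ε))
  (y≤x ε 0<ε)

x≤y⇒x≈x⊓y : ∀ x y → x ≤ y → x ≈ x ⊓ y
x≤y⇒x≈x⊓y x y x≤y ε 0<ε = Eventually-map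
  (λ k a≤b+ε → let a = seq x k ; b = seq y k in
    ≤+ε⇒∣-∣≤ε a (a ℚ.⊓ b)
      -- Here ε stands outside the minimum, so `a` is read as `a ⊓ a` and compared argument by
      -- argument with `a ⊓ b`.
      (subst (ℚ._≤ (a ℚ.⊓ b) ℚ.+ ε) (ℚₚ.⊓-idem a) (⊓-≤+ε a a a b (p≤p+ε a 0<ε) a≤b+ε))
      (ℚₚ.≤-trans (ℚₚ.p⊓q≤p a b) (p≤p+ε a 0<ε)))
  (x≤y ε 0<ε)

x≤y⇒y≈x⊔y : ∀ x y → x ≤ y → y ≈ x ⊔ y
x≤y⇒y≈x⊔y x y x≤y = ≈-trans y (y ⊔ x) (x ⊔ y) (y≤x⇒x≈x⊔y y x x≤y)
  (≡⇒≈ (y ⊔ x) (x ⊔ y) (λ k → ℚₚ.⊔-comm (seq y k) (seq x k)))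

y≤x⇒y≈x⊓y : ∀ x y → y ≤ x → y ≈ x ⊓ y
y≤x⇒y≈x⊓y x y y≤x = ≈-trans y (y ⊓ x) (x ⊓ y) (x≤y⇒x≈x⊓y y x y≤x)
  (≡⇒≈ (y ⊓ x) (x ⊓ y) (λ k → ℚₚ.⊓-comm (seq y k) (seq x k)))

-- The order depends only on the termwise difference. This turns a bound on `r` into a comparison of
-- the two lines at 0 or 1.
≤-byDifference : ∀ x y x′ y′ →
  (∀ k → seq x′ k ℚ.- seq y′ k ≡ seq x k ℚ.- seq y k) → x ≤ y → x′ ≤ y′
≤-byDifference x y x′ y′ eq x≤y ε 0<ε = Eventually-map
  (λ k h → begin
    seq x′ k
      ≡⟨ q+[p-q]≡p (seq x′ k) (seq y′ k) ⟨
    seq y′ k ℚ.+ (seq x′ k ℚ.- seq y′ k)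
      ≡⟨ cong (seq y′ k ℚ.+_) (eq k) ⟩
    seq y′ k ℚ.+ (seq x k ℚ.- seq y k)
      ≤⟨ ℚₚ.+-monoʳ-≤ (seq y′ k) (p≤q+ε⇒p-q≤ε (seq x k) (seq y k) h) ⟩
    seq y′ k ℚ.+ ε ∎)
  (x≤y ε 0<ε)
  where open ℚₚ.≤-Reasoning

-- The line of slope a with value 0 at 0, and the line of slope b with value r at 1.
line₀ : (a t : ℝ) → ℝ
line₀ a t = a * t

line₁ : (b r t : ℝ) → ℝ
line₁ b r t = r + b * t - b

-- Replaces `t` by the exact constant `c`, where the rational identities apply term by term. The
-- operation is left abstract so that max and min share the argument.
*≈∙-resp : ∀ _∙_ → Congruent _∙_ → ∀ a b r t c → t ≈ c →
  c * r ≈ (line₀ a c ∙ line₁ b r c) → t * r ≈ (line₀ a t ∙ line₁ b r t)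
*≈∙-resp _∙_ ∙-cong a b r t c t≈c eq = begin
  t * r                    ≈⟨ *-cong t c r r t≈c (≈-refl r) ⟩
  c * r                    ≈⟨ eq ⟩
  line₀ a c ∙ line₁ b r c  ≈⟨ ∙-cong (line₀ a c) (line₀ a t) (line₁ b r c) (line₁ b r t)
                                (at a)
                                (+-cong (r + b * c) (r + b * t) (- b) (- b)
                                  (+-cong r r (b * c) (b * t) (≈-refl r) (at b))
                                  (≈-refl (- b))) ⟩
  line₀ a t ∙ line₁ b r t  ∎
  where
  open SetoidReasoning ≈-setoid
  at : ∀ d → d * c ≈ d * t
  at d = *-cong d d c t (≈-refl d) (≈-sym t c t≈c)

-- Products with a binary factor.

0*r≈line₀ : ∀ a r → 0ℝ * r ≈ line₀ a 0ℝ
0*r≈line₀ a r = ≡⇒≈ (0ℝ * r) (line₀ a 0ℝ) λ k →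
  0r≡a0 (seq a k) (seq r k)

1*r≈line₁ : ∀ b r → 1ℝ * r ≈ line₁ b r 1ℝ
1*r≈line₁ b r = ≡⇒≈ (1ℝ * r) (line₁ b r 1ℝ) λ k →
  1r≡r+b1-b (seq b k) (seq r k)

-- The bounds on `r` are conditional because each extremum is taken over one slice of the
-- relaxation, and so constrains `r` only when `t` has the value defining that slice.
binary-*≈⊔ : ∀ a b r t → t ≈ 0ℝ ⊎ t ≈ 1ℝ → (t ≈ 0ℝ → r ≤ b) → (t ≈ 1ℝ → a ≤ r) →
  t * r ≈ line₀ a t ⊔ line₁ b r t
binary-*≈⊔ a b r t (inj₁ t≈0) r≤b _ = *≈∙-resp _⊔_ ⊔-cong a b r t 0ℝ t≈0
  (≈-trans (0ℝ * r) (line₀ a 0ℝ) (line₀ a 0ℝ ⊔ line₁ b r 0ℝ) (0*r≈line₀ a r)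
    (y≤x⇒x≈x⊔y (line₀ a 0ℝ) (line₁ b r 0ℝ)
      (≤-byDifference r b (line₁ b r 0ℝ) (line₀ a 0ℝ)
        (λ k → [r+b0-b]-a0≡r-b (seq a k) (seq b k) (seq r k)) (r≤b t≈0))))
binary-*≈⊔ a b r t (inj₂ t≈1) _ a≤r = *≈∙-resp _⊔_ ⊔-cong a b r t 1ℝ t≈1
  (≈-trans (1ℝ * r) (line₁ b r 1ℝ) (line₀ a 1ℝ ⊔ line₁ b r 1ℝ) (1*r≈line₁ b r)
    (x≤y⇒y≈x⊔y (line₀ a 1ℝ) (line₁ b r 1ℝ)
      (≤-byDifference a r (line₀ a 1ℝ) (line₁ b r 1ℝ)
        (λ k → a1-[r+b1-b]≡a-r (seq a k) (seq b k) (seq r k)) (a≤r t≈1))))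

binary-*≈⊓ : ∀ a b r t → t ≈ 0ℝ ⊎ t ≈ 1ℝ → (t ≈ 0ℝ → b ≤ r) → (t ≈ 1ℝ → r ≤ a) →
  t * r ≈ line₀ a t ⊓ line₁ b r t
binary-*≈⊓ a b r t (inj₁ t≈0) b≤r _ = *≈∙-resp _⊓_ ⊓-cong a b r t 0ℝ t≈0
  (≈-trans (0ℝ * r) (line₀ a 0ℝ) (line₀ a 0ℝ ⊓ line₁ b r 0ℝ) (0*r≈line₀ a r)
    (x≤y⇒x≈x⊓y (line₀ a 0ℝ) (line₁ b r 0ℝ)
      (≤-byDifference b r (line₀ a 0ℝ) (line₁ b r 0ℝ)
        (λ k → a0-[r+b0-b]≡b-r (seq a k) (seq b k) (seq r k)) (b≤r t≈0))))
binary-*≈⊓ a b r t (inj₂ t≈1) _ r≤a = *≈∙-resp _⊓_ ⊓-cong a b r t 1ℝ t≈1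
  (≈-trans (1ℝ * r) (line₁ b r 1ℝ) (line₀ a 1ℝ ⊓ line₁ b r 1ℝ) (1*r≈line₁ b r)
    (y≤x⇒y≈x⊓y (line₀ a 1ℝ) (line₁ b r 1ℝ)
      (≤-byDifference r a (line₁ b r 1ℝ) (line₀ a 1ℝ)
        (λ k → [r+b1-b]-a1≡r-a (seq a k) (seq b k) (seq r k)) (r≤a t≈1))))

lemma4p1 : {ℓ₁ ℓ₂ : Level} (n : ℕ)
    (X : Pred (Vector ℝ n) ℓ₁) → Extensional X → X ⊆ BinaryVectors n →
    (Q : Matrix n) → Symmetric Q →
    (X̄ : Pred (Vector ℝ n) ℓ₂) → Extensional X̄ → X ⊆ X̄ →
    (γ̄₁ γ̲₁ γ̄₂ γ̲₂ : Vector ℝ n) →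
    (∀ i → IsMax (RowValues Q X̄ i 0ℝ) (γ̄₁ i)) →
    (∀ i → IsMin (RowValues Q X̄ i 1ℝ) (γ̲₁ i)) →
    (∀ i → IsMax (RowValues Q X̄ i 1ℝ) (γ̄₂ i)) →
    (∀ i → IsMin (RowValues Q X̄ i 0ℝ) (γ̲₂ i)) →
    ∀ x → x ∈ X → ∀ i →
    (x i * (Q i · x) ≈ (γ̲₁ i * x i) ⊔ ((Q i · x) + γ̄₁ i * x i - γ̄₁ i)) ×
    (x i * (Q i · x) ≈ (γ̄₂ i * x i) ⊓ ((Q i · x) + γ̲₂ i * x i - γ̲₂ i))
lemma4p1 n X _ X⊆Bin Q _ X̄ _ X⊆X̄ γ̄₁ γ̲₁ γ̄₂ γ̲₂ max₀ min₁ max₁ min₀ x x∈X i =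
  binary-*≈⊔ (γ̲₁ i) (γ̄₁ i) (Q i · x) (x i) (X⊆Bin x∈X i)
    (λ xᵢ≈0 → let _ , ≤γ̄₁ = max₀ i in ≤γ̄₁ {Q i · x} (rowValue 0ℝ xᵢ≈0))
    (λ xᵢ≈1 → let _ , γ̲₁≤ = min₁ i in γ̲₁≤ {Q i · x} (rowValue 1ℝ xᵢ≈1)) ,
  binary-*≈⊓ (γ̄₂ i) (γ̲₂ i) (Q i · x) (x i) (X⊆Bin x∈X i)
    (λ xᵢ≈0 → let _ , γ̲₂≤ = min₀ i in γ̲₂≤ {Q i · x} (rowValue 0ℝ xᵢ≈0))
    (λ xᵢ≈1 → let _ , ≤γ̄₂ = max₁ i in ≤γ̄₂ {Q i · x} (rowValue 1ℝ xᵢ≈1))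
  where
  -- The witness is `x` itself: as a point of the relaxation with the prescribed coordinate, it has
  -- a row value subject to the extremal bounds of that slice.
  rowValue : ∀ c → x i ≈ c → RowValues Q X̄ i c (Q i · x)
  rowValue c xᵢ≈c = x , (X⊆X̄ x∈X , xᵢ≈c) , ≈-refl (Q i · x)
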